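{- For every list (any length, any initial order) and every request sequence $\sigma$, in the full cost model, $$\min\{\mathrm{TS}(\sigma),\mathrm{MTFO}(\sigma),\mathrm{MTFE}(\sigma)\}\le \tfrac{5}{3}\,\mathrm{OPT}(\sigma).$$ Consequently, a deterministic online algorithm that receives two advice bits indicating which of TS, MTFO, MTFE has the smallest cost on $\sigma$ and then runs it has cost at most $\frac53\mathrm{OPT}(\sigma)$ on every $\sigma$.
   Context: Static list update problem: a list of $l$ distinct items in some initial order; a request sequence $\sigma$ is served in order. Serving a request to the item at position $i$ (positions $1,\dots,l$ from the front) costs $i$ (full cost model). Immediately after an access, the accessed item may be moved closer to the front at no cost (free exchange); at any time two adjacent items may be swapped at cost $1$ (paid exchange). $A(\sigma)$ is the total cost of algorithm $A$ on $\sigma$; $\mathrm{OPT}(\sigma)$ is the minimum cost of any offline algorithm on $\sigma$; all algorithms start from the same initial list. MTFO (Move-To-Front-Odd) moves a requested item to the front (by a free exchange) on the 1st, 3rd, 5th, ... request to that item, and otherwise leaves it in place. MTFE (Move-To-Front-Even) moves a requested item to the front on the 2nd, 4th, 6th, ... request to that item, and otherwise leaves it in place. TS (Timestamp): on a request to item $x$, if $x$ has been requested before and some item preceding $x$ in the list has been requested at most once since the previous request to $x$, then $x$ is moved (free exchange) to immediately in front of the frontmost such item; otherwise no item is moved. None of these algorithms makes paid exchanges. -}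

module Defs where

open import Data.Bool using (Bool; true; false; if_then_else_)
open import Data.Fin using (Fin; zero; suc)
open import Data.List using (List; []; _∷_; allFin; cartesianProductWith; filter; length; map; takeWhile)
open import Data.Nat.Properties using (≤-trans; ≤-total; ≤-totalOrder; m≤m+n; m≤n+m)
open import Data.List.Extrema ≤-totalOrder using (argmin; f[argmin]≤f[⊤]; f[argmin]≤f[xs])
open import Data.List.Membership.Propositional using (_∈_)
open import Data.List.Membership.Propositional.Properties using (∈-allFin; ∈-cartesianProductWith⁺; ∈-map⁺)
import Data.List.Membership.DecPropositional as DecMembership
import Data.List.Relation.Unary.All as All
open import Data.List.Relation.Unary.Any using (here; there)
open import Data.Maybe using (Maybe; just; nothing)
import Data.Maybe as Maybe
open import Data.Nat using (ℕ; zero; suc; pred; parity; _+_; _≤_; s≤s; _≤?_)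
open import Data.Parity using (Parity; 0ℙ; 1ℙ)
import Data.Parity.Properties as Parity
open import Data.Sum using (inj₁; inj₂)
open import Data.Vec using (Vec; []; _∷_)
open import Relation.Binary.Definitions using (DecidableEquality)
open import Relation.Binary.PropositionalEquality using (refl)
open import Relation.Nullary using (does)
open import Relation.Nullary.Decidable using (¬?)
open import Relation.Unary using (Pred; Decidable)

-- Everything done while serving one request to a list of length l: the adjacent
-- pairs swapped before the access (i stands for the pair at indices i, i + 1),
-- the 0-based index to which the accessed item is moved for free (`nothing`: it
-- stays), and the adjacent pairs swapped after that.
record Response (l : ℕ) : Set where
  constructor response
  field
    before : List (Fin (pred l))
    free   : Maybe (Fin l)
    after  : List (Fin (pred l))

open Response public

freeOnly : ∀ {l} → Maybe (Fin l) → Response l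
freeOnly m = response [] m []

front : ∀ {l} → Maybe (Fin l)
front {zero}  = nothing
front {suc _} = just zero

module _ {a} {A : Set a} where

  swapAt : ∀ {l} → Fin (pred l) → Vec A l → Vec A l
  swapAt zero    (x ∷ y ∷ L) = y ∷ x ∷ L
  swapAt (suc i) (x ∷ y ∷ L) = x ∷ swapAt i (y ∷ L)

  swaps : ∀ {l} → List (Fin (pred l)) → Vec A l → Vec A l
  swaps []       L = L
  swaps (i ∷ is) L = swaps is (swapAt i L)

  insertSecond : ∀ {l} → A → Vec A l → Vec A (suc l)
  insertSecond y []      = y ∷ []
  insertSecond y (z ∷ L) = z ∷ y ∷ L

-- The static list update problem. Operations that take an item x and a list are
-- only meaningful when x occurs in the list; their values otherwise are arbitrary.
module ListUpdate {a} {A : Set a} (_≟_ : DecidableEquality A) where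

  open DecMembership _≟_ using (_∈?_)

  -- 1-based.
  position : ∀ {l} → A → Vec A l → ℕ
  position x []      = 0
  position x (y ∷ L) = if does (x ≟ y) then 1 else suc (position x L)

  toFront : ∀ {l} → A → Vec A l → Vec A l
  toFront x []      = []
  toFront x (y ∷ L) = if does (x ≟ y) then y ∷ L else insertSecond y (toFront x L)

  -- Free exchanges only move x towards the front: an index behind x has no effect.
  moveTo : ∀ {l} → Maybe (Fin l) → A → Vec A l → Vec A l
  moveTo nothing        x L       = L
  moveTo (just zero)    x L       = toFront x L
  moveTo (just (suc k)) x (y ∷ L) = if does (x ≟ y) then y ∷ L else y ∷ moveTo (just k) x L

  serveCost : ∀ {l} → Response l → A → Vec A l → ℕ
  serveCost r x L = length (before r) + position x (swaps (before r) L) + length (after r)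

  serve : ∀ {l} → Response l → A → Vec A l → Vec A l
  serve r x L = swaps (after r) (moveTo (free r) x (swaps (before r) L))

  -- An offline algorithm is free to choose any schedule for the request sequence.
  Schedule : ℕ → List A → Set
  Schedule l σ = Vec (Response l) (length σ)

  scheduleCost : ∀ {l} → Vec A l → (σ : List A) → Schedule l σ → ℕ
  scheduleCost L []      []      = 0
  scheduleCost L (x ∷ σ) (r ∷ s) = serveCost r x L + scheduleCost (serve r x L) σ s

  -- OPT is computed by searching the schedules that make at most B swaps before and
  -- at most B swaps after each access, B being the cost of never changing the list.
  -- Any other schedule costs more than B; OPT-minimal states that OPT is a lower
  -- bound for all schedules.

  idle : ∀ {l} (σ : List A) → Schedule l σ
  idle []      = []
  idle (_ ∷ σ) = freeOnly nothing ∷ idle σ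

  swapLists : ∀ {n} → ℕ → List (List (Fin n))
  swapLists     zero    = [] ∷ []
  swapLists {n} (suc B) = [] ∷ cartesianProductWith _∷_ (allFin n) (swapLists B)

  freeMoves : ∀ {l} → List (Maybe (Fin l))
  freeMoves {l} = nothing ∷ map just (allFin l)

  responses : ∀ {l} → ℕ → List (Response l)
  responses B =
    cartesianProductWith (λ f p → f p) (cartesianProductWith response (swapLists B) freeMoves) (swapLists B)

  schedules : ∀ {l} → ℕ → (σ : List A) → List (Schedule l σ)
  schedules B []      = [] ∷ []
  schedules B (_ ∷ σ) = cartesianProductWith _∷_ (responses B) (schedules B σ)

  optimal : ∀ {l} → Vec A l → (σ : List A) → Schedule l σ
  optimal L σ = argmin (scheduleCost L σ) (idle σ) (schedules (scheduleCost L σ (idle σ)) σ)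

  OPT : ∀ {l} → Vec A l → List A → ℕ
  OPT L σ = scheduleCost L σ (optimal L σ)

  ∈-swapLists : ∀ {n B} (p : List (Fin n)) → length p ≤ B → p ∈ swapLists B
  ∈-swapLists {B = zero}  []      _         = here refl
  ∈-swapLists {B = suc _} []      _         = here refl
  ∈-swapLists             (i ∷ p) (s≤s p≤B) =
    there (∈-cartesianProductWith⁺ _∷_ (∈-allFin i) (∈-swapLists p p≤B))

  ∈-freeMoves : ∀ {l} (m : Maybe (Fin l)) → m ∈ freeMoves
  ∈-freeMoves nothing  = here refl
  ∈-freeMoves (just k) = there (∈-map⁺ just (∈-allFin k))

  ∈-responses : ∀ {l B} (r : Response l) → length (before r) ≤ B → length (after r) ≤ B → r ∈ responses B
  ∈-responses (response b m c) b≤B c≤B =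
    ∈-cartesianProductWith⁺ (λ f p → f p)
      (∈-cartesianProductWith⁺ response (∈-swapLists b b≤B) (∈-freeMoves m)) (∈-swapLists c c≤B)

  ∈-schedules : ∀ {l B} (L : Vec A l) σ (s : Schedule l σ) → scheduleCost L σ s ≤ B → s ∈ schedules B σ
  ∈-schedules L []      []      _   = here refl
  ∈-schedules L (x ∷ σ) (r ∷ s) c≤B = ∈-cartesianProductWith⁺ _∷_
    (∈-responses r
      (≤-trans (≤-trans (m≤m+n _ _) (m≤m+n _ (length (after r)))) r≤B)
      (≤-trans (m≤n+m _ (length (before r) + position x (swaps (before r) L))) r≤B))
    (∈-schedules (serve r x L) σ s (≤-trans (m≤n+m _ (serveCost r x L)) c≤B))
    where
    r≤B = ≤-trans (m≤m+n (serveCost r x L) (scheduleCost (serve r x L) σ s)) c≤B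

  OPT-minimal : ∀ {l} (L : Vec A l) σ (s : Schedule l σ) → OPT L σ ≤ scheduleCost L σ s
  OPT-minimal L σ s with ≤-total (scheduleCost L σ s) (scheduleCost L σ (idle σ))
  ... | inj₁ s≤idle = All.lookup
          (f[argmin]≤f[xs] {f = scheduleCost L σ} (idle σ) (schedules (scheduleCost L σ (idle σ)) σ))
          (∈-schedules L σ s s≤idle)
  ... | inj₂ idle≤s = ≤-trans
          (f[argmin]≤f[⊤] {f = scheduleCost L σ} (idle σ) (schedules (scheduleCost L σ (idle σ)) σ)) idle≤s

  -- A deterministic online algorithm sees the initial list, the earlier requests
  -- (most recent first), the current list and the current request.
  OnlineAlgorithm : ℕ → Set a
  OnlineAlgorithm l = (initial : Vec A l) (past : List A) (current : Vec A l) (x : A) → Response l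

  runFrom : ∀ {l} → OnlineAlgorithm l → Vec A l → List A → Vec A l → (σ : List A) → Schedule l σ
  runFrom alg L₀ past L []      = []
  runFrom alg L₀ past L (x ∷ σ) = r ∷ runFrom alg L₀ (x ∷ past) (serve r x L) σ
    where r = alg L₀ past L x

  cost : ∀ {l} → OnlineAlgorithm l → Vec A l → List A → ℕ
  cost alg L σ = scheduleCost L σ (runFrom alg L [] L σ)

  occurrences : A → List A → ℕ
  occurrences x xs = length (filter (x ≟_) xs)

  moveToFrontOnParity : ∀ {l} → Parity → OnlineAlgorithm l
  moveToFrontOnParity p _ past _ x =
    freeOnly (if does (parity (suc (occurrences x past)) Parity.≟ p) then front else nothing)

  MTFO : ∀ {l} → OnlineAlgorithm l
  MTFO = moveToFrontOnParity 1ℙ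

  MTFE : ∀ {l} → OnlineAlgorithm l
  MTFE = moveToFrontOnParity 0ℙ

  -- Index of the frontmost item preceding x that satisfies P.
  frontmostBefore : ∀ {p} {P : Pred A p} → Decidable P → ∀ {l} → A → Vec A l → Maybe (Fin l)
  frontmostBefore P? x []      = nothing
  frontmostBefore P? x (y ∷ L) =
    if does (x ≟ y) then nothing
    else if does (P? y) then just zero
    else Maybe.map suc (frontmostBefore P? x L)

  sincePrevious : A → List A → List A
  sincePrevious x past = takeWhile (λ y → ¬? (x ≟ y)) past

  TS : ∀ {l} → OnlineAlgorithm l
  TS _ past L x = freeOnly
    (if does (x ∈? past)
     then frontmostBefore (λ y → occurrences y (sincePrevious x past) ≤? 1) x L
     else nothing)

  data Candidate : Set where
    ts mtfo mtfe : Candidate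

  algorithm : ∀ {l} → Candidate → OnlineAlgorithm l
  algorithm ts   = TS
  algorithm mtfo = MTFO
  algorithm mtfe = MTFE

  -- Three of the four values of the two bits suffice; the fourth is a synonym.
  decode : Vec Bool 2 → Candidate
  decode (false ∷ false ∷ []) = ts
  decode (false ∷ true  ∷ []) = mtfo
  decode (true  ∷ _     ∷ []) = mtfe

  AlgorithmWithAdvice : ℕ → ℕ → Set a
  AlgorithmWithAdvice b l = Vec Bool b → OnlineAlgorithm l

  bestOfThree : ∀ {l} → AlgorithmWithAdvice 2 l
  bestOfThree advice = algorithm (decode advice)

  IndicatesCheapest : ∀ {l} → Vec Bool 2 → Vec A l → List A → Set
  IndicatesCheapest advice L σ = ∀ c → cost (algorithm (decode advice)) L σ ≤ cost (algorithm c) L σ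

{-# OPTIONS --safe #-}
module Submission where

-- Every list operation decomposes over pairs of items: u is charged for a request
-- to u served while v precedes it, and for a paid swap in which u overtakes v.
-- Restricted to a pair, TS, MTFO, MTFE and the offline list form a finite system.
-- On it the three algorithms together pay at most 5 times what the offline
-- algorithm pays, by a potential that is checked exhaustively and vanishes
-- initially. Summing over all pairs, the minimum is at most the average, 5/3 OPT.

open import Defs
open import Data.Bool using (Bool; T; true; false; if_then_else_; not; _∧_; _∨_)
open import Data.Bool.Properties using (∧-zeroʳ; ∨-identityʳ; ∨-zeroʳ; ∨-∧-booleanAlgebra)
open import Algebra.Lattice.Properties.BooleanAlgebra ∨-∧-booleanAlgebra using (deMorgan₂)
open import Data.Fin using (Fin; zero; suc; toℕ)
import Data.Fin as Fin
import Data.Fin.Properties as Fin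
open import Data.List using (List; []; _∷_; length; map; take)
import Data.List.Membership.DecPropositional as DecMembership
open import Data.List.Membership.Propositional using () renaming (_∈_ to _∈ₗ_; _∉_ to _∉ₗ_)
open import Data.List.Relation.Binary.Permutation.Propositional using (_↭_; ↭-refl; ↭-sym; ↭-trans; prep; swap; ↭⇒↭ₛ)
open import Data.List.Relation.Binary.Permutation.Propositional.Properties using (∈-resp-↭)
import Data.List.Relation.Binary.Permutation.Setoid.Properties as Permutation
open import Data.List.Relation.Unary.All as All using (All; []; _∷_)
open import Data.List.Relation.Unary.AllPairs using ([]; _∷_)
open import Data.List.Relation.Unary.Any as Any using (here; there)
open import Data.List.Relation.Unary.Unique.Propositional using () renaming (Unique to Uniqueₗ)
open import Data.Maybe using (Maybe; just; nothing)
import Data.Maybe as Maybe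
open import Data.Nat using (ℕ; zero; suc; pred; parity; _+_; _*_; _∸_; _⊓_; _⊔_; _≤_; _≤?_; z≤n; s≤s; s≤s⁻¹)
open import Data.Nat.ListAction using (sum)
open import Data.Nat.Properties
open import Data.Nat.Tactic.RingSolver using (solve-∀)
open import Algebra.Properties.CommutativeSemigroup +-commutativeSemigroup using (interchange; x∙yz≈y∙xz)
open import Data.Parity using (Parity; 0ℙ; 1ℙ)
import Data.Parity.Properties as Parity
open import Data.Product using (_×_; _,_; ∃-syntax)
open import Data.Sum using (_⊎_; inj₁; inj₂)
open import Data.Unit using (tt)
open import Data.Vec using (Vec; []; _∷_; toList)
open import Data.Vec.Membership.Propositional using (_∈_)
open import Data.Vec.Membership.Propositional.Properties using (∈-toList⁺)
open import Data.Vec.Relation.Unary.All.Properties using (toList⁺)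
open import Data.Vec.Relation.Unary.AllPairs using ([]; _∷_)
open import Data.Vec.Relation.Unary.Unique.Propositional using (Unique)
open import Function using (_∘_)
open import Relation.Binary.Definitions using (DecidableEquality)
open import Relation.Binary.PropositionalEquality
open import Relation.Nullary using (Dec; yes; no; does; ¬_; contradiction)
open import Relation.Nullary.Decidable using (map′; _×-dec_; dec-true; dec-false; from-yes)
open import Relation.Unary using (Pred; Decidable)

-- The obstacle is TS. Its rule names the frontmost eligible item of the whole list, so it is not
-- evident that the order of two items depends only on the requests to these two. It does, because
-- the invariant `RecencyOrdered` makes the eligible items a suffix of the list: the requested item
-- then passes exactly the eligible items ahead of it, and eligibility of one item against another
-- is a counter with values 0, 1, 2. MTFO and MTFE share one parity bit per item and read it
-- oppositely. The potential is built for an offline list that stands still, although the real one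
-- may change. Two facts bridge the gap: reversing the offline order of a pair raises the potential
-- by at most 5, which is 5 times the price of a paid exchange; and a free exchange after a delayed
-- access costs a pair as much as a paid exchange just before that access, namely 1. The full cost
-- model adds to each access one unit that belongs to no pair. It counts 3 on the left and 5 on the
-- right, so it only helps.

𝟙 : Bool → ℕ
𝟙 b = if b then 1 else 0

-- The finite system on a single pair of items

-- Projection of a request to a pair of items: true is the first item of the pair,
-- false the second; nothing is a request to any other item.
Request : Set
Request = Maybe Bool

delay : Request → Bool → ℕ
delay (just true)  b = 𝟙 (not b)
delay (just false) b = 𝟙 b
delay nothing      b = 0

moveFront : Request → (ifFst ifSnd : Bool) → Bool → Bool
moveFront (just true)  m n b = b ∨ m
moveFront (just false) m n b = b ∧ not n
moveFront nothing      m n b = b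

toggle : Request → Bool → Bool
toggle (just true)  b = not b
toggle (just false) b = b
toggle nothing      b = b

-- TS moves an item ahead of another one iff it holds credit against it: an item
-- has 2 credits after its own request and loses one per request to the other.
recharge : Request → Fin 3 → Fin 3
recharge (just true)  c = suc (suc zero)
recharge (just false) c = Fin.pred c
recharge nothing      c = c

positive : Fin 3 → Bool
positive zero    = false
positive (suc _) = true

flip : Request → Request
flip (just b) = just (not b)
flip nothing  = nothing

-- The xFst say whether x has the first item in front, oddFst and oddSnd whether
-- the next request to the item is an odd one.
record PairState : Set where
  constructor pairState
  field
    tsFst oFst eFst     : Bool
    oddFst oddSnd       : Bool
    creditFst creditSnd : Fin 3

open PairState public

next : Request → PairState → PairState
next r (pairState t o e p q c d) = pairState
  (moveFront r (positive c) (positive d) t)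
  (moveFront r p q o)
  (moveFront r (not p) (not q) e)
  (toggle r p) (toggle (flip r) q)
  (recharge r c) (recharge (flip r) d)

delays : Request → PairState → ℕ
delays r s = delay r (tsFst s) + delay r (oFst s) + delay r (eFst s)

-- The most by which the three algorithms can exceed 5 times the offline cost in k
-- requests if the offline list never changes. Four rounds reach a fixed point.
excess : ℕ → Bool → PairState → ℕ
excess zero    b s = 0
excess (suc k) b s = gain true ⊔ gain false
  where
  gain : Bool → ℕ
  gain x = (delays (just x) s + excess k b (next (just x) s)) ∸ 5 * delay (just x) b

-- The potential and its exhaustive verification

opaque
  potential : Bool → PairState → ℕ
  potential = excess 4

private
  ∀Bool? : ∀ {p} {P : Bool → Set p} → (∀ b → Dec (P b)) → Dec (∀ b → P b)
  ∀Bool? P? = map′ (λ { (t , f) true → t ; (t , f) false → f }) (λ p → p true , p false)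
    (P? true ×-dec P? false)

  ∀PairState? : ∀ {p} {P : PairState → Set p} → (∀ s → Dec (P s)) → Dec (∀ s → P s)
  ∀PairState? P? = map′ (λ p s → p (tsFst s) (oFst s) (eFst s) (oddFst s) (oddSnd s) (creditFst s) (creditSnd s))
    (λ p _ _ _ _ _ _ _ → p _)
    (∀Bool? λ t → ∀Bool? λ o → ∀Bool? λ e → ∀Bool? λ p → ∀Bool? λ q →
     Fin.all? λ c → Fin.all? λ d → P? (pairState t o e p q c d))

opaque
  unfolding potential

  -- The state at the start: all four lists agree, the next request to either item is its first and
  -- hence odd, and without past requests there is no credit.
  potential-initial : ∀ b → potential b (pairState b b b true true zero zero) ≡ 0
  potential-initial true  = refl
  potential-initial false = refl

  -- The two indicators are the two directions in which a pair can be reversed, matching the way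
  -- `overtakes` charges ordered pairs.
  potential-reorder : ∀ b b′ s →
    potential b′ s ≤ potential b s + 5 * (𝟙 (not b ∧ b′) + 𝟙 (b ∧ not b′))
  potential-reorder = from-yes (∀Bool? λ b → ∀Bool? λ b′ → ∀PairState? λ s →
    potential b′ s ≤? potential b s + 5 * (𝟙 (not b ∧ b′) + 𝟙 (b ∧ not b′)))

  private
    -- Arbitrary `m` and `n` cover every free exchange of the offline algorithm. The check ranges
    -- over unreachable states too, such as two credits of 2, so no reachability invariant has to be
    -- carried along.
    potential-just : ∀ x m n b s →
      delays (just x) s + potential (moveFront (just x) m n b) (next (just x) s) ≤
      potential b s + 5 * delay (just x) b
    potential-just = from-yes (∀Bool? λ x → ∀Bool? λ m → ∀Bool? λ n → ∀Bool? λ b → ∀PairState? λ s →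
      delays (just x) s + potential (moveFront (just x) m n b) (next (just x) s) ≤?
      potential b s + 5 * delay (just x) b)

  potential-request : ∀ r m n b s →
    delays r s + potential (moveFront r m n b) (next r s) ≤ potential b s + 5 * delay r b
  potential-request (just x) m n b s = potential-just x m n b s
  potential-request nothing  m n b s = m≤m+n (potential b s) 0

-- Sums over items and over ordered pairs

module _ {a} {A : Set a} where

  Σ[_] : List A → (A → ℕ) → ℕ
  Σ[ I ] f = sum (map f I)

  Σ-mono : ∀ I {f g : A → ℕ} → (∀ {u} → u ∈ₗ I → f u ≤ g u) → Σ[ I ] f ≤ Σ[ I ] g
  Σ-mono []      f≤g = z≤n
  Σ-mono (u ∷ I) f≤g = +-mono-≤ (f≤g (here refl)) (Σ-mono I (f≤g ∘ there))

  Σ-cong : ∀ I {f g : A → ℕ} → (∀ {u} → u ∈ₗ I → f u ≡ g u) → Σ[ I ] f ≡ Σ[ I ] g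
  Σ-cong []      f≡g = refl
  Σ-cong (u ∷ I) f≡g = cong₂ _+_ (f≡g (here refl)) (Σ-cong I (f≡g ∘ there))

  Σ-zero : ∀ I → Σ[ I ] (λ _ → 0) ≡ 0
  Σ-zero []      = refl
  Σ-zero (_ ∷ I) = Σ-zero I

  Σ-+ : ∀ I (f g : A → ℕ) → Σ[ I ] (λ u → f u + g u) ≡ Σ[ I ] f + Σ[ I ] g
  Σ-+ []      f g = refl
  Σ-+ (u ∷ I) f g = trans (cong (f u + g u +_) (Σ-+ I f g)) (interchange (f u) (g u) _ _)

  Σ-* : ∀ k I (f : A → ℕ) → Σ[ I ] (λ u → k * f u) ≡ k * Σ[ I ] f
  Σ-* k []      f = sym (*-zeroʳ k)
  Σ-* k (u ∷ I) f = trans (cong (k * f u +_) (Σ-* k I f)) (sym (*-distribˡ-+ k (f u) _))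

  ΣΣ[_] : List A → (A → A → ℕ) → ℕ
  ΣΣ[ I ] f = Σ[ I ] λ u → Σ[ I ] (f u)

  ΣΣ-mono : ∀ I {f g : A → A → ℕ} → (∀ {u v} → u ∈ₗ I → v ∈ₗ I → f u v ≤ g u v) → ΣΣ[ I ] f ≤ ΣΣ[ I ] g
  ΣΣ-mono I f≤g = Σ-mono I λ u∈I → Σ-mono I (f≤g u∈I)

  ΣΣ-zero : ∀ I → ΣΣ[ I ] (λ _ _ → 0) ≡ 0
  ΣΣ-zero I = trans (Σ-cong I (λ _ → Σ-zero I)) (Σ-zero I)

  ΣΣ-+ : ∀ I (f g : A → A → ℕ) → ΣΣ[ I ] (λ u v → f u v + g u v) ≡ ΣΣ[ I ] f + ΣΣ[ I ] g
  ΣΣ-+ I f g = trans (Σ-cong I (λ _ → Σ-+ I _ _)) (Σ-+ I _ _)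

  ΣΣ-* : ∀ k I (f : A → A → ℕ) → ΣΣ[ I ] (λ u v → k * f u v) ≡ k * ΣΣ[ I ] f
  ΣΣ-* k I f = trans (Σ-cong I (λ _ → Σ-* k I _)) (Σ-* k I _)

  private
    Σ-exchange : ∀ I J (f : A → A → ℕ) → Σ[ I ] (λ u → Σ[ J ] (f u)) ≡ Σ[ J ] (λ v → Σ[ I ] (λ u → f u v))
    Σ-exchange []      J f = sym (Σ-zero J)
    Σ-exchange (u ∷ I) J f = trans (cong (Σ[ J ] (f u) +_) (Σ-exchange I J f)) (sym (Σ-+ J (f u) _))

  -- Charges are made to ordered pairs, while the potential bounds both directions together. Summing
  -- over all ordered pairs counts each unordered one twice, which avoids choosing an order on `A`.
  ΣΣ-symmetrise : ∀ I (f : A → A → ℕ) → ΣΣ[ I ] (λ u v → f u v + f v u) ≡ 2 * ΣΣ[ I ] f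
  ΣΣ-symmetrise I f = begin
    ΣΣ[ I ] (λ u v → f u v + f v u)          ≡⟨ ΣΣ-+ I f (λ u v → f v u) ⟩
    ΣΣ[ I ] f + ΣΣ[ I ] (λ u v → f v u)      ≡⟨ cong (ΣΣ[ I ] f +_) (Σ-exchange I I f) ⟨
    ΣΣ[ I ] f + ΣΣ[ I ] f                    ≡⟨ cong (ΣΣ[ I ] f +_) (+-identityʳ _) ⟨
    2 * ΣΣ[ I ] f                            ∎
    where open ≡-Reasoning

  Unique-resp-↭ : ∀ {I J : List A} → I ↭ J → Uniqueₗ I → Uniqueₗ J
  Unique-resp-↭ I↭J = Permutation.Unique-resp-↭ (setoid A) (↭⇒↭ₛ I↭J)

-- Lists as precedence relations

module PairwiseAnalysis {a} {A : Set a} (_≟_ : DecidableEquality A) where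

  open ListUpdate _≟_
  open DecMembership _≟_ using (_∈?_)

  Σ-single : ∀ {I b} (f : A → ℕ) → Uniqueₗ I → b ∈ₗ I → Σ[ I ] (λ u → if does (u ≟ b) then f u else 0) ≡ f b
  Σ-single {_ ∷ I} {b} f (b≢ ∷ _) (here refl) rewrite dec-true (b ≟ b) refl = trans
    (cong (f b +_) (trans (Σ-cong I absent) (Σ-zero I))) (+-identityʳ (f b))
    where
    absent : ∀ {u} → u ∈ₗ I → (if does (u ≟ b) then f u else 0) ≡ 0
    absent {u} u∈I rewrite dec-false (u ≟ b) (≢-sym (All.lookup b≢ u∈I)) = refl
  Σ-single {c ∷ I} {b} f (c≢ ∷ uI) (there b∈I)
    rewrite dec-false (c ≟ b) (All.lookup c≢ b∈I) = Σ-single f uI b∈I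

  -- Testing `v` before `u` makes the relation irreflexive, so that diagonal pairs cost nothing. A
  -- missing item counts as behind every item present.
  precedes : ∀ {l} → A → A → Vec A l → Bool
  precedes u v []      = false
  precedes u v (y ∷ L) = if does (v ≟ y) then false else if does (u ≟ y) then true else precedes u v L

  precedes-head : ∀ {l u v} (L : Vec A l) → u ≢ v → precedes u v (u ∷ L) ≡ true
  precedes-head {u = u} {v} L u≢v
    rewrite dec-false (v ≟ u) (≢-sym u≢v) | dec-true (u ≟ u) refl = refl

  precedes-tail : ∀ {l u v y} (L : Vec A l) → u ≢ y → v ≢ y → precedes u v (y ∷ L) ≡ precedes u v L
  precedes-tail {u = u} {v} {y} L u≢y v≢y
    rewrite dec-false (v ≟ y) v≢y | dec-false (u ≟ y) u≢y = refl

  precedes-cong : ∀ {l l′ u v} y (L : Vec A l) (M : Vec A l′) →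
    precedes u v L ≡ precedes u v M → precedes u v (y ∷ L) ≡ precedes u v (y ∷ M)
  precedes-cong {u = u} {v} y L M L≡M with v ≟ y | u ≟ y
  ... | yes _ | _     = refl
  ... | no _  | yes _ = refl
  ... | no _  | no _  = L≡M

  precedes-irrefl : ∀ {l} u (L : Vec A l) → precedes u u L ≡ false
  precedes-irrefl u []      = refl
  precedes-irrefl u (y ∷ L) with u ≟ y
  ... | yes _ = refl
  ... | no  _ = precedes-irrefl u L

  precedes-∉ : ∀ {l u v} (L : Vec A l) → u ∉ₗ toList L → precedes u v L ≡ false
  precedes-∉                 []      u∉L = refl
  precedes-∉ {u = u} {v} (y ∷ L) u∉L with v ≟ y | u ≟ y
  ... | yes _ | _        = refl
  ... | no _  | yes refl = contradiction (here refl) u∉L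
  ... | no _  | no  _    = precedes-∉ L (u∉L ∘ there)

  precedes-flip : ∀ {l u v} (L : Vec A l) → u ≢ v → u ∈ₗ toList L → v ∈ₗ toList L →
    precedes v u L ≡ not (precedes u v L)
  precedes-flip {u = u} {v} (y ∷ L) u≢v u∈L v∈L with u ≟ y | v ≟ y
  ... | yes refl | yes refl = contradiction refl u≢v
  ... | yes _    | no  _    = refl
  ... | no  _    | yes _    = refl
  ... | no u≢y   | no v≢y   = precedes-flip L u≢v (Any.tail u≢y u∈L) (Any.tail v≢y v∈L)

  precedes-asym : ∀ {l} u v (L : Vec A l) → precedes v u L ∧ precedes u v L ≡ false
  precedes-asym u v []      = refl
  precedes-asym u v (y ∷ L) with u ≟ y | v ≟ y
  ... | yes _ | yes _ = refl
  ... | yes _ | no  _ = refl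
  ... | no  _ | yes _ = refl
  ... | no  _ | no  _ = precedes-asym u v L

  -- The range `I` may be larger than the list, so that the induction can pass to the tail while the
  -- sum keeps its range.
  position-pairwise : ∀ {l I x} (L : Vec A l) → Uniqueₗ (toList L) → Uniqueₗ I → (∀ {y} → y ∈ₗ toList L → y ∈ₗ I) →
    x ∈ₗ toList L → position x L ≡ suc (Σ[ I ] λ y → 𝟙 (precedes y x L))
  position-pairwise {I = I} {x} (z ∷ L) (z≢ ∷ uL) uI L⊆I x∈ with x ≟ z
  ... | yes _  = cong suc (sym (Σ-zero I))
  ... | no x≢z = cong suc (begin
    position x L
      ≡⟨ position-pairwise L uL uI (L⊆I ∘ there) (Any.tail x≢z x∈) ⟩
    1 + Σ[ I ] (λ y → 𝟙 (precedes y x L))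
      ≡⟨ cong (_+ Σ[ I ] (λ y → 𝟙 (precedes y x L))) (Σ-single (λ _ → 1) uI (L⊆I (here refl))) ⟨
    Σ[ I ] (λ y → 𝟙 (does (y ≟ z))) + Σ[ I ] (λ y → 𝟙 (precedes y x L))
      ≡⟨ Σ-+ I _ _ ⟨
    Σ[ I ] (λ y → 𝟙 (does (y ≟ z)) + 𝟙 (precedes y x L))
      ≡⟨ Σ-cong I (λ {y} _ → split y) ⟩
    Σ[ I ] (λ y → 𝟙 (if does (y ≟ z) then true else precedes y x L))
      ∎)
    where
    open ≡-Reasoning
    split : ∀ y → 𝟙 (does (y ≟ z)) + 𝟙 (precedes y x L) ≡ 𝟙 (if does (y ≟ z) then true else precedes y x L)
    split y with y ≟ z
    ... | yes refl = cong (suc ∘ 𝟙) (precedes-∉ L (λ z∈L → All.lookup z≢ z∈L refl))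
    ... | no _     = refl

  -- Effect of free and paid exchanges on the order of a pair

  swapAt-↭ : ∀ {l} i (L : Vec A l) → toList (swapAt i L) ↭ toList L
  swapAt-↭ zero    (x ∷ y ∷ L) = swap y x ↭-refl
  swapAt-↭ (suc i) (x ∷ y ∷ L) = prep x (swapAt-↭ i (y ∷ L))

  swaps-↭ : ∀ {l} is (L : Vec A l) → toList (swaps is L) ↭ toList L
  swaps-↭ []       L = ↭-refl
  swaps-↭ (i ∷ is) L = ↭-trans (swaps-↭ is (swapAt i L)) (swapAt-↭ i L)

  insertSecond-↭ : ∀ {l} y (L : Vec A l) → toList (insertSecond y L) ↭ y ∷ toList L
  insertSecond-↭ y []      = ↭-refl
  insertSecond-↭ y (z ∷ L) = swap z y ↭-refl

  toFront-↭ : ∀ {l} x (L : Vec A l) → toList (toFront x L) ↭ toList L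
  toFront-↭ x []      = ↭-refl
  toFront-↭ x (y ∷ L) with x ≟ y
  ... | yes _ = ↭-refl
  ... | no  _ = ↭-trans (insertSecond-↭ y (toFront x L)) (prep y (toFront-↭ x L))

  moveTo-↭ : ∀ {l} m x (L : Vec A l) → toList (moveTo m x L) ↭ toList L
  moveTo-↭ nothing        x L       = ↭-refl
  moveTo-↭ (just zero)    x L       = toFront-↭ x L
  moveTo-↭ (just (suc k)) x (y ∷ L) with x ≟ y
  ... | yes _ = ↭-refl
  ... | no  _ = prep y (moveTo-↭ (just k) x L)

  serve-↭ : ∀ {l} r x (L : Vec A l) → toList (serve r x L) ↭ toList L
  serve-↭ r x L = ↭-trans (swaps-↭ (after r) _) (↭-trans (moveTo-↭ (free r) x _) (swaps-↭ (before r) L))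

  -- `R` is the list without `x`. With `x` known to head the recursive result, `insertSecond` puts
  -- each passed item directly behind it.
  toFront-shape : ∀ {l x} (L : Vec A (suc l)) → x ∈ₗ toList L → ∃[ R ]
    toFront x L ≡ x ∷ R × (∀ {u v} → u ≢ x → v ≢ x → precedes u v R ≡ precedes u v L)
  toFront-shape {x = x} (y ∷ L) x∈ with x ≟ y
  ... | yes refl = L , refl , λ u≢x v≢x → sym (precedes-tail L u≢x v≢x)
  toFront-shape {x = x} (y ∷ z ∷ L) x∈ | no x≢y with toFront-shape (z ∷ L) (Any.tail x≢y x∈)
  ... | R , eq , others rewrite eq = y ∷ R , refl , λ u≢x v≢x → precedes-cong y R (z ∷ L) (others u≢x v≢x)
  toFront-shape {x = x} (y ∷ []) (here refl) | no x≢y = contradiction refl x≢y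

  toFront-precedes : ∀ {l x v} (L : Vec A l) → x ∈ₗ toList L → v ≢ x → precedes x v (toFront x L) ≡ true
  toFront-precedes L@(_ ∷ _) x∈L v≢x with toFront-shape L x∈L
  ... | R , eq , _ rewrite eq = precedes-head R (≢-sym v≢x)

  moveTo-others : ∀ {l x u v} m (L : Vec A l) → x ∈ₗ toList L → u ≢ x → v ≢ x →
    precedes u v (moveTo m x L) ≡ precedes u v L
  moveTo-others nothing L x∈L u≢x v≢x = refl
  moveTo-others (just zero) L x∈L u≢x v≢x with toFront-shape L x∈L
  ... | R , eq , others rewrite eq = trans (precedes-tail R u≢x v≢x) (others u≢x v≢x)
  moveTo-others {x = x} (just (suc k)) (y ∷ L) x∈L u≢x v≢x with x ≟ y
  ... | yes _  = refl
  ... | no x≢y = precedes-cong y (moveTo (just k) x L) L (moveTo-others (just k) L (Any.tail x≢y x∈L) u≢x v≢x)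

  moveTo-advances : ∀ {l x v} m (L : Vec A l) → x ∈ₗ toList L → v ≢ x →
    precedes x v L ≡ true → precedes x v (moveTo m x L) ≡ true
  moveTo-advances nothing L x∈L v≢x x<v = x<v
  moveTo-advances (just zero) L x∈L v≢x x<v = toFront-precedes L x∈L v≢x
  moveTo-advances {x = x} {v} (just (suc k)) (y ∷ L) x∈L v≢x x<v with x ≟ y
  ... | yes refl = precedes-head L (≢-sym v≢x)
  ... | no x≢y with v ≟ y
  ...   | no v≢y rewrite dec-false (x ≟ y) x≢y = moveTo-advances (just k) L (Any.tail x≢y x∈L) v≢x x<v

  request : A → A → A → Request
  request x u v = if does (u ≟ x) then just true else if does (v ≟ x) then just false else nothing

  request-flip : ∀ {u v} x → u ≢ v → request x v u ≡ flip (request x u v)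
  request-flip {u} {v} x u≢v with u ≟ x | v ≟ x
  ... | yes refl | yes refl = contradiction refl u≢v
  ... | yes _    | no _     = refl
  ... | no _     | yes _    = refl
  ... | no _     | no _     = refl

  -- It suffices to know which items `x` passes: the pairs with `x` in second place follow by
  -- complementation, the others do not change. `moved` is a parameter because it is the credit for
  -- TS, the parity for MTFO and MTFE, and the outcome itself for the offline list.
  moveTo-precedes : ∀ {l x u v} m (L : Vec A l) (moved : A → A → Bool) →
    x ∈ₗ toList L → u ∈ₗ toList L → v ∈ₗ toList L → u ≢ v →
    (∀ {w} → w ∈ₗ toList L → w ≢ x → precedes x w (moveTo m x L) ≡ precedes x w L ∨ moved x w) →
    precedes u v (moveTo m x L) ≡ moveFront (request x u v) (moved u v) (moved v u) (precedes u v L)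
  moveTo-precedes {x = x} {u} {v} m L moved x∈L u∈L v∈L u≢v spec with u ≟ x | v ≟ x
  ... | yes refl | _        = spec v∈L (≢-sym u≢v)
  ... | no u≢x   | no v≢x   = moveTo-others m L x∈L u≢x v≢x
  ... | no u≢x   | yes refl = begin
    precedes u x (moveTo m x L)            ≡⟨ precedes-flip (moveTo m x L) (≢-sym u≢x) (stays x∈L) (stays u∈L) ⟩
    not (precedes x u (moveTo m x L))      ≡⟨ cong not (spec u∈L u≢x) ⟩
    not (precedes x u L ∨ moved x u)       ≡⟨ deMorgan₂ (precedes x u L) _ ⟩
    not (precedes x u L) ∧ not (moved x u) ≡⟨ cong (_∧ not (moved x u)) (precedes-flip L (≢-sym u≢x) x∈L u∈L) ⟨
    precedes u x L ∧ not (moved x u)       ∎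
    where
    open ≡-Reasoning
    stays : ∀ {w} → w ∈ₗ toList L → w ∈ₗ toList (moveTo m x L)
    stays = ∈-resp-↭ (↭-sym (moveTo-↭ m x L))

  -- An adjacent swap reverses one pair only: `d` overtakes `c`. The product of two tests makes the
  -- double sum collapse to 1, the price of the swap.
  swapAt-overtakes : ∀ {l} i (L : Vec A l) → Uniqueₗ (toList L) → ∃[ c ] ∃[ d ]
    c ∈ₗ toList L × d ∈ₗ toList L ×
    (∀ u v → precedes v u L ∧ precedes u v (swapAt i L) ≡ does (u ≟ d) ∧ does (v ≟ c))
  swapAt-overtakes zero (c ∷ d ∷ L) ((c≢d ∷ _) ∷ _) = c , d , here refl , there (here refl) , spec
    where
    spec : ∀ u v → precedes v u (c ∷ d ∷ L) ∧ precedes u v (d ∷ c ∷ L) ≡ does (u ≟ d) ∧ does (v ≟ c)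
    spec u v with u ≟ c | u ≟ d | v ≟ c | v ≟ d
    ... | yes refl | yes refl | _        | _        = contradiction refl c≢d
    ... | _        | _        | yes refl | yes refl = contradiction refl c≢d
    ... | yes _    | no _     | yes _    | no _     = refl
    ... | yes _    | no _     | no _     | yes _    = refl
    ... | yes _    | no _     | no _     | no _     = refl
    ... | no _     | yes _    | yes _    | no _     = refl
    ... | no _     | yes _    | no _     | yes _    = refl
    ... | no _     | yes _    | no _     | no _     = refl
    ... | no _     | no _     | yes _    | no _     = refl
    ... | no _     | no _     | no _     | yes _    = refl
    ... | no _     | no _     | no _     | no _     = precedes-asym u v L
  swapAt-overtakes (suc i) (x ∷ y ∷ L) (x≢ ∷ uL) with swapAt-overtakes i (y ∷ L) uL
  ... | c , d , c∈ , d∈ , spec = c , d , there c∈ , there d∈ , spec′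
    where
    spec′ : ∀ u v → precedes v u (x ∷ y ∷ L) ∧ precedes u v (x ∷ swapAt i (y ∷ L)) ≡ does (u ≟ d) ∧ does (v ≟ c)
    spec′ u v = trans (step u v) (spec u v)
      where
      step : ∀ u v → precedes v u (x ∷ y ∷ L) ∧ precedes u v (x ∷ swapAt i (y ∷ L)) ≡
                     precedes v u (y ∷ L) ∧ precedes u v (swapAt i (y ∷ L))
      step u v with u ≟ x | v ≟ x
      ... | no u≢x | no v≢x = refl
      ... | yes refl | yes refl = sym (trans (spec x x) (cong (_∧ does (x ≟ c)) (dec-false (x ≟ d) (All.lookup x≢ d∈))))
      ... | yes refl | no _ = sym (trans (spec x v) (cong (_∧ does (v ≟ c)) (dec-false (x ≟ d) (All.lookup x≢ d∈))))
      ... | no u≢x | yes refl = sym (trans (spec u x) (trans (cong (does (u ≟ d) ∧_) (dec-false (x ≟ c) (All.lookup x≢ c∈))) (∧-zeroʳ (does (u ≟ d)))))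

  -- Decomposition of costs into charges to ordered pairs

  overtakes : ∀ {l} → List (Fin (pred l)) → Vec A l → A → A → ℕ
  overtakes []       L u v = 0
  overtakes (i ∷ is) L u v = 𝟙 (precedes v u L ∧ precedes u v (swapAt i L)) + overtakes is (swapAt i L) u v

  pairAccess : ∀ {l} → A → Vec A l → A → A → ℕ
  pairAccess x L u v = if does (u ≟ x) then 𝟙 (precedes v u L) else 0

  pairServe : ∀ {l} → Response l → A → Vec A l → A → A → ℕ
  pairServe r x L u v =
    overtakes (before r) L u v + pairAccess x L₁ u v + overtakes (after r) (moveTo (free r) x L₁) u v
    where L₁ = swaps (before r) L

  pairCost : ∀ {l} → Vec A l → (σ : List A) → Schedule l σ → A → A → ℕ
  pairCost L []      []      u v = 0
  pairCost L (x ∷ σ) (r ∷ s) u v = pairServe r x L u v + pairCost (serve r x L) σ s u v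

  module Arrangements {I : List A} (uI : Uniqueₗ I) where

    overtakes-sum : ∀ {l} is (L : Vec A l) → toList L ↭ I → ΣΣ[ I ] (overtakes is L) ≡ length is
    overtakes-sum []       L L↭I = ΣΣ-zero I
    overtakes-sum (i ∷ is) L L↭I with swapAt-overtakes i L (Unique-resp-↭ (↭-sym L↭I) uI)
    ... | c , d , c∈ , d∈ , spec = begin
      ΣΣ[ I ] (overtakes (i ∷ is) L)
        ≡⟨ ΣΣ-+ I _ _ ⟩
      ΣΣ[ I ] (λ u v → 𝟙 (precedes v u L ∧ precedes u v (swapAt i L))) + ΣΣ[ I ] (overtakes is (swapAt i L))
        ≡⟨ cong₂ _+_ single (overtakes-sum is (swapAt i L) (↭-trans (swapAt-↭ i L) L↭I)) ⟩
      suc (length is)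
        ∎
      where
      open ≡-Reasoning
      inner : ∀ u → Σ[ I ] (λ v → 𝟙 (precedes v u L ∧ precedes u v (swapAt i L))) ≡ (if does (u ≟ d) then 1 else 0)
      inner u = trans (Σ-cong I (λ {v} _ → cong 𝟙 (spec u v))) (conj (does (u ≟ d)))
        where
        conj : ∀ b → Σ[ I ] (λ v → 𝟙 (b ∧ does (v ≟ c))) ≡ 𝟙 b
        conj true  = Σ-single (λ _ → 1) uI (∈-resp-↭ L↭I c∈)
        conj false = Σ-zero I
      single : ΣΣ[ I ] (λ u v → 𝟙 (precedes v u L ∧ precedes u v (swapAt i L))) ≡ 1
      single = trans (Σ-cong I (λ {u} _ → inner u)) (Σ-single (λ _ → 1) uI (∈-resp-↭ L↭I d∈))

    pairAccess-sum : ∀ {l x} (L : Vec A l) → toList L ↭ I → x ∈ₗ I → suc (ΣΣ[ I ] (pairAccess x L)) ≡ position x L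
    pairAccess-sum {x = x} L L↭I x∈I = sym (trans
      (position-pairwise L (Unique-resp-↭ (↭-sym L↭I) uI) uI (∈-resp-↭ L↭I) (∈-resp-↭ (↭-sym L↭I) x∈I))
      (cong suc (sym (trans (Σ-cong I (λ {u} _ → pull (does (u ≟ x)))) (Σ-single _ uI x∈I)))))
      where
      pull : ∀ {f : A → ℕ} b → Σ[ I ] (λ v → if b then f v else 0) ≡ (if b then Σ[ I ] f else 0)
      pull true  = refl
      pull false = Σ-zero I

    pairServe-sum : ∀ {l x} r (L : Vec A l) → toList L ↭ I → x ∈ₗ I → suc (ΣΣ[ I ] (pairServe r x L)) ≡ serveCost r x L
    pairServe-sum {x = x} r L L↭I x∈I = begin
      suc (ΣΣ[ I ] (pairServe r x L))
        ≡⟨ cong suc (trans (ΣΣ-+ I _ _) (cong (_+ ΣΣ[ I ] (overtakes (after r) L₂)) (ΣΣ-+ I _ _))) ⟩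
      suc (ΣΣ[ I ] (overtakes (before r) L) + ΣΣ[ I ] (pairAccess x L₁) + ΣΣ[ I ] (overtakes (after r) L₂))
        ≡⟨ cong (_+ ΣΣ[ I ] (overtakes (after r) L₂)) (+-suc (ΣΣ[ I ] (overtakes (before r) L)) _) ⟨
      ΣΣ[ I ] (overtakes (before r) L) + suc (ΣΣ[ I ] (pairAccess x L₁)) + ΣΣ[ I ] (overtakes (after r) L₂)
        ≡⟨ cong₂ _+_ (cong₂ _+_ (overtakes-sum (before r) L L↭I) (pairAccess-sum L₁ L₁↭I x∈I))
                     (overtakes-sum (after r) L₂ (↭-trans (moveTo-↭ (free r) x L₁) L₁↭I)) ⟩
      serveCost r x L
        ∎
      where
      open ≡-Reasoning
      L₁ = swaps (before r) L
      L₂ = moveTo (free r) x L₁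
      L₁↭I = ↭-trans (swaps-↭ (before r) L) L↭I

    -- The term `length σ` collects the unit that each access pays for the requested item itself,
    -- positions being counted from 1.
    scheduleCost-pairwise : ∀ {l} (L : Vec A l) → toList L ↭ I → ∀ σ → All (_∈ₗ I) σ → ∀ s →
      scheduleCost L σ s ≡ length σ + ΣΣ[ I ] (pairCost L σ s)
    scheduleCost-pairwise L L↭I []      []          []      = sym (ΣΣ-zero I)
    scheduleCost-pairwise L L↭I (x ∷ σ) (x∈I ∷ σ⊆I) (r ∷ s) = begin
      serveCost r x L + scheduleCost L′ σ s
        ≡⟨ cong₂ _+_ (sym (pairServe-sum r L L↭I x∈I))
                     (scheduleCost-pairwise L′ (↭-trans (serve-↭ r x L) L↭I) σ σ⊆I s) ⟩
      suc (ΣΣ[ I ] (pairServe r x L)) + (length σ + ΣΣ[ I ] (pairCost L′ σ s))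
        ≡⟨ cong suc (x∙yz≈y∙xz (ΣΣ[ I ] (pairServe r x L)) (length σ) _) ⟩
      suc (length σ) + (ΣΣ[ I ] (pairServe r x L) + ΣΣ[ I ] (pairCost L′ σ s))
        ≡⟨ cong (suc (length σ) +_) (ΣΣ-+ I _ _) ⟨
      suc (length σ) + ΣΣ[ I ] (pairCost L (x ∷ σ) (r ∷ s))
        ∎
      where
      open ≡-Reasoning
      L′ = serve r x L

  -- The rules of MTFO, MTFE and TS on a pair

  odd : A → List A → Bool
  odd x past = does (parity (suc (occurrences x past)) Parity.≟ 1ℙ)

  private
    suc-odd : ∀ n → does (parity (suc n) Parity.≟ 1ℙ) ≡ not (does (parity n Parity.≟ 1ℙ))
    suc-odd n with parity (suc n) | parity n | Parity.suc-homo-⁻¹ n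
    ... | 0ℙ | _ | refl = refl
    ... | 1ℙ | _ | refl = refl

  odd-even : ∀ p → does (p Parity.≟ 0ℙ) ≡ not (does (p Parity.≟ 1ℙ))
  odd-even 0ℙ = refl
  odd-even 1ℙ = refl

  odd-toggle : ∀ u v x past → odd u (x ∷ past) ≡ toggle (request x u v) (odd u past)
  odd-toggle u v x past with u ≟ x | v ≟ x
  ... | yes refl | _     = suc-odd (suc (occurrences u past))
  ... | no _     | yes _ = refl
  ... | no _     | no  _ = refl

  front-precedes : ∀ {l x} b (L : Vec A l) → x ∈ₗ toList L → ∀ {w} → w ∈ₗ toList L → w ≢ x →
    precedes x w (moveTo (if b then front else nothing) x L) ≡ precedes x w L ∨ b
  front-precedes {x = x} true  L@(_ ∷ _) x∈L w∈L w≢x = trans (toFront-precedes L x∈L w≢x) (sym (∨-zeroʳ _))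
  front-precedes false L x∈L w∈L w≢x = sym (∨-identityʳ _)

  -- The closure hypothesis says that the items satisfying `P` form a suffix. Moving in front of the
  -- first of them therefore passes no item outside `P`, and the rule can be read off each pair
  -- separately.
  frontmostBefore-precedes : ∀ {p} {P : Pred A p} (P? : Decidable P) {l x} (L : Vec A l) → Uniqueₗ (toList L) → x ∈ₗ toList L →
    (∀ {y w} → y ∈ₗ toList L → w ∈ₗ toList L → precedes y w L ≡ true → P y → P w) →
    ∀ {w} → w ∈ₗ toList L → w ≢ x →
    precedes x w (moveTo (frontmostBefore P? x L) x L) ≡ precedes x w L ∨ does (P? w)
  frontmostBefore-precedes P? {x = x} (y ∷ L) (y≢ ∷ uL) x∈ closed {w} w∈ w≢x
    with toFront-precedes (y ∷ L) x∈ w≢x | x ≟ y | P? y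
  ... | x<w | yes refl | _      rewrite dec-false (w ≟ y) w≢x | dec-true (y ≟ y) refl = refl
  ... | x<w | no x≢y   | yes Py = trans x<w (sym (trans (cong (_ ∨_) (dec-true (P? w) Pw)) (∨-zeroʳ _)))
    where
    Pw : _
    Pw with w ≟ y
    ... | yes refl = Py
    ... | no w≢y   = closed (here refl) w∈ (precedes-head L (≢-sym w≢y)) Py
  ... | x<w | no x≢y | no ¬Py = trans (cong (precedes x w) (moveTo-suc (frontmostBefore P? x L))) tail
    where
    moveTo-suc : ∀ m → moveTo (Maybe.map suc m) x (y ∷ L) ≡ y ∷ moveTo m x L
    moveTo-suc nothing                                  = refl
    moveTo-suc (just _) rewrite dec-false (x ≟ y) x≢y = refl
    tail : precedes x w (y ∷ moveTo (frontmostBefore P? x L) x L) ≡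
           (if does (w ≟ y) then false else precedes x w L) ∨ does (P? w)
    tail rewrite dec-false (x ≟ y) x≢y with w ≟ y
    ... | yes refl = sym (dec-false (P? w) ¬Py)
    ... | no w≢y   = frontmostBefore-precedes P? L uL (Any.tail x≢y x∈) closed′ (Any.tail w≢y w∈) w≢x
      where
      closed′ : ∀ {u v} → u ∈ₗ toList L → v ∈ₗ toList L → precedes u v L ≡ true → _ → _
      closed′ u∈ v∈ u<v = closed (there u∈) (there v∈)
        (trans (precedes-tail L (≢-sym (All.lookup y≢ u∈)) (≢-sym (All.lookup y≢ v∈))) u<v)

  credit : A → A → List A → Fin 3
  credit u v []         = zero
  credit u v (x ∷ past) = recharge (request x u v) (credit u v past)

  -- The counter stops at zero just as `∸` truncates. Starting it at 2 makes it positive exactly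
  -- while `v` has been requested at most once since, which is the condition of TS.
  toℕ-credit : ∀ {u v} past → u ≢ v →
    toℕ (credit u v past) ≡ (if does (u ∈? past) then 2 ∸ occurrences v (sincePrevious u past) else 0)
  toℕ-credit         []         u≢v = refl
  toℕ-credit {u} {v} (x ∷ past) u≢v with toℕ-credit past u≢v | u ≟ x | v ≟ x in v≟x
  ... | ih | yes _ | _     = refl
  ... | ih | no _  | yes _ rewrite v≟x = trans (toℕ-pred (credit u v past)) (trans (cong pred ih) (pred-if (does (u ∈? past)) (occurrences v (sincePrevious u past))))
    where
    toℕ-pred : ∀ {n} (i : Fin n) → toℕ (Fin.pred i) ≡ pred (toℕ i)
    toℕ-pred zero    = refl
    toℕ-pred (suc i) = Fin.toℕ-inject₁ i
    pred-if : ∀ b n → pred (if b then 2 ∸ n else 0) ≡ (if b then 2 ∸ suc n else 0)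
    pred-if true n  = pred[m∸n]≡m∸[1+n] 2 n
    pred-if false n = refl
  ... | ih | no _  | no _  rewrite v≟x = ih

  positive-credit : ∀ {u v} past → u ≢ v →
    positive (credit u v past) ≡ does (u ∈? past) ∧ does (occurrences v (sincePrevious u past) ≤? 1)
  positive-credit {u} {v} past u≢v with does (u ∈? past) | credit u v past | toℕ-credit past u≢v
  ... | false | zero             | _  = refl
  ... | true  | c                | eq = bounded c (occurrences v (sincePrevious u past)) eq
    where
    bounded : ∀ (c : Fin 3) n → toℕ c ≡ 2 ∸ n → positive c ≡ does (n ≤? 1)
    bounded (suc zero)    1             _ = refl
    bounded (suc (suc _)) 0             _ = refl
    bounded zero          (suc (suc n)) _ = refl
    bounded (suc _)       (suc (suc n)) eq = contradiction (trans eq (0∸n≡0 n)) λ ()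

  positive-credit⁻ : ∀ {u v} past → u ≢ v → positive (credit u v past) ≡ true →
    occurrences v (sincePrevious u past) ≤ 1
  positive-credit⁻ {u} {v} past u≢v pos with does (u ∈? past) | trans (sym (positive-credit past u≢v)) pos
  ... | true | few = ≤ᵇ⇒≤ _ 1 (subst T (sym few) tt)

  positive-credit⁺ : ∀ {u v} past → u ≢ v → u ∈ₗ past → occurrences v (sincePrevious u past) ≤ 1 →
    positive (credit u v past) ≡ true
  positive-credit⁺ {u} past u≢v u∈past few = trans (positive-credit past u≢v)
    (cong₂ _∧_ (dec-true (u ∈? past) u∈past) (dec-true (_ ≤? 1) few))

  -- The link between the rule of TS and `RecencyOrdered`, which compares second most recent
  -- requests without timestamps: every prefix of the past with two requests to the later item has
  -- two to the earlier one.
  sincePrevious-take : ∀ x past → ∃[ n ] sincePrevious x past ≡ take n past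
  sincePrevious-take x []         = 0 , refl
  sincePrevious-take x (y ∷ past) with x ≟ y | sincePrevious-take x past
  ... | yes _ | _      = 0 , refl
  ... | no  _ | n , eq = suc n , cong (y ∷_) eq

  -- A prefix of the past that misses `x` lies within the stretch since the previous request to `x`.
  take-before : ∀ x y past n → occurrences x (take n past) ≡ 0 →
    occurrences y (take n past) ≤ occurrences y (sincePrevious x past)
  take-before x y past       zero    _  = z≤n
  take-before x y []         (suc n) _  = z≤n
  take-before x y (z ∷ past) (suc n) x∉ with x ≟ z | y ≟ z in y≟z
  ... | no _ | yes _ rewrite y≟z = s≤s (take-before x y past n x∉)
  ... | no _ | no  _ rewrite y≟z = take-before x y past n x∉

  -- A prefix that meets `x` contains that whole stretch.
  take-beyond : ∀ x y past n → 1 ≤ occurrences x (take n past) →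
    occurrences y (sincePrevious x past) ≤ occurrences y (take n past)
  take-beyond x y (z ∷ past) (suc n) x∈ with x ≟ z | y ≟ z in y≟z
  ... | yes _ | _     = z≤n
  ... | no _  | yes _ rewrite y≟z = s≤s (take-beyond x y past n x∈)
  ... | no _  | no  _ rewrite y≟z = take-beyond x y past n x∈

  take-∈ : ∀ x past n → 1 ≤ occurrences x (take n past) → x ∈ₗ past
  take-∈ x (y ∷ past) (suc n) x∈ with x ≟ y
  ... | yes refl = here refl
  ... | no _     = there (take-∈ x past n x∈)

  -- TS keeps its list sorted by the time of the second most recent request.
  RecencyOrdered : ∀ {l} → List A → Vec A l → Set a
  RecencyOrdered past L = ∀ {y w} → y ∈ₗ toList L → w ∈ₗ toList L → precedes y w L ≡ true →
    ∀ n → 2 ≤ occurrences w (take n past) → 2 ≤ occurrences y (take n past)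

  tsMove : ∀ {l} → List A → Vec A l → A → Maybe (Fin l)
  tsMove past L x = free (TS L past L x)

  -- Here TS becomes pairwise: the invariant, applied to the prefix since the previous request to
  -- `x`, provides the closure that `frontmostBefore-precedes` asks for.
  tsMove-precedes : ∀ {l x} past (L : Vec A l) → Uniqueₗ (toList L) → RecencyOrdered past L → x ∈ₗ toList L →
    ∀ {w} → w ∈ₗ toList L → w ≢ x →
    precedes x w (moveTo (tsMove past L x) x L) ≡ precedes x w L ∨ positive (credit x w past)
  tsMove-precedes {x = x} past L uL ordered x∈L {w} w∈L w≢x
    rewrite positive-credit past (≢-sym w≢x) with does (x ∈? past)
  ... | false = sym (∨-identityʳ _)
  ... | true  = frontmostBefore-precedes (λ y → occurrences y (sincePrevious x past) ≤? 1) L uL x∈L closed w∈L w≢x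
    where
    closed : ∀ {y w} → y ∈ₗ toList L → w ∈ₗ toList L → precedes y w L ≡ true →
      occurrences y (sincePrevious x past) ≤ 1 → occurrences w (sincePrevious x past) ≤ 1
    closed {y} {w} y∈ w∈ y<w few with sincePrevious-take x past
    ... | n , eq rewrite eq = ≮⇒≥ λ many → <⇒≱ (ordered y∈ w∈ y<w n many) few

  RecencyOrdered-[] : ∀ {l} (L : Vec A l) → RecencyOrdered [] L
  RecencyOrdered-[] L y∈ w∈ y<w (suc n) ()
  RecencyOrdered-[] L y∈ w∈ y<w zero    ()

  -- The new request turns the most recent earlier request to `x` into its second most recent one.
  -- Only pairs with `x` need an argument, and for them the credit decides on which side of the
  -- other item `x` ends up.
  RecencyOrdered-tsMove : ∀ {l x} past (L : Vec A l) → Uniqueₗ (toList L) → RecencyOrdered past L → x ∈ₗ toList L →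
    RecencyOrdered (x ∷ past) (moveTo (tsMove past L x) x L)
  RecencyOrdered-tsMove past L uL ordered x∈L y∈ w∈ y<w zero ()
  RecencyOrdered-tsMove {x = x} past L uL ordered x∈L {y} {w} y∈′ w∈′ y<w (suc n) twice
    with ∈-resp-↭ (moveTo-↭ (tsMove past L x) x L) y∈′ | ∈-resp-↭ (moveTo-↭ (tsMove past L x) x L) w∈′ | y ≟ x | w ≟ x
  ... | _   | _   | yes refl | yes refl = contradiction (trans (sym y<w) (precedes-irrefl x (moveTo (tsMove past L x) x L))) λ ()
  ... | y∈L | w∈L | no y≢x   | no w≢x   =
    ordered y∈L w∈L (trans (sym (moveTo-others (tsMove past L x) L x∈L y≢x w≢x)) y<w) n twice
  ... | _   | w∈L | yes refl | no w≢x   = s≤s x∈take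
    where
    x∈take : 1 ≤ occurrences x (take n past)
    x∈take with precedes x w L in x<w | positive (credit x w past) in moves
                | tsMove-precedes past L uL ordered x∈L w∈L w≢x
    ... | true  | _     | _  = ≤-trans (n≤1+n 1) (ordered x∈L w∈L x<w n twice)
    ... | false | false | eq = contradiction (trans (sym y<w) eq) λ ()
    ... | false | true  | _  with occurrences x (take n past) in absent
    -- If the prefix missed `x`, both requests to `w` in it would fall after the previous request to
    -- `x`, and `x` would have no credit to pass `w`.
    ...   | zero  = contradiction (≤-trans twice (take-before x w past n absent))
                      (<⇒≱ (s≤s (positive-credit⁻ past (≢-sym w≢x) moves)))
    ...   | suc _ = s≤s z≤n
  -- `x` has stayed behind `y`, so `y` was requested at least twice since the previous request to
  -- `x`; the prefix contains that request and hence the whole stretch.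
  ... | y∈L | _   | no y≢x   | yes refl = ≤-trans (≰⇒> many) (take-beyond x y past n (s≤s⁻¹ twice))
    where
    many : ¬ occurrences y (sincePrevious x past) ≤ 1
    many few = contradiction
      (begin
        true                                                ≡⟨ y<w ⟨
        precedes y x (moveTo (tsMove past L x) x L)         ≡⟨ precedes-flip _ (≢-sym y≢x) w∈′ y∈′ ⟩
        not (precedes x y (moveTo (tsMove past L x) x L))   ≡⟨ cong not (tsMove-precedes past L uL ordered x∈L y∈L y≢x) ⟩
        not (precedes x y L ∨ positive (credit x y past))
          ≡⟨ cong (λ b → not (precedes x y L ∨ b)) (positive-credit⁺ past (≢-sym y≢x) (take-∈ x past n (s≤s⁻¹ twice)) few) ⟩
        not (precedes x y L ∨ true)                         ≡⟨ cong not (∨-zeroʳ _) ⟩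
        false                                               ∎)
      λ ()
      where open ≡-Reasoning

  mtfMove : ∀ {l} → Parity → List A → A → Maybe (Fin l)
  mtfMove p past x = if does (parity (suc (occurrences x past)) Parity.≟ p) then front else nothing

  -- The potential argument for a fixed pair

  module _ {u v : A} (u≢v : u ≢ v) where

    pairAccess-delay : ∀ {l} x (L : Vec A l) → u ∈ₗ toList L → v ∈ₗ toList L →
      pairAccess x L u v + pairAccess x L v u ≡ delay (request x u v) (precedes u v L)
    pairAccess-delay x L u∈ v∈ with u ≟ x | v ≟ x
    ... | yes refl | yes refl = contradiction refl u≢v
    ... | yes _    | no _     = trans (+-identityʳ _) (cong 𝟙 (precedes-flip L u≢v u∈ v∈))
    ... | no _     | yes _    = refl
    ... | no _     | no _     = refl

    freeOnly-cost : ∀ {l} x (L : Vec A l) m σ s → u ∈ₗ toList L → v ∈ₗ toList L →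
      pairCost L (x ∷ σ) (freeOnly m ∷ s) u v + pairCost L (x ∷ σ) (freeOnly m ∷ s) v u ≡
      delay (request x u v) (precedes u v L) +
      (pairCost (moveTo m x L) σ s u v + pairCost (moveTo m x L) σ s v u)
    freeOnly-cost x L m σ s u∈ v∈ = trans
      (cong₂ (λ i j → i + pairCost L′ σ s u v + (j + pairCost L′ σ s v u))
        (+-identityʳ (pairAccess x L u v)) (+-identityʳ (pairAccess x L v u)))
      (trans (interchange (pairAccess x L u v) (pairCost L′ σ s u v) (pairAccess x L v u) (pairCost L′ σ s v u))
        (cong (_+ (pairCost L′ σ s u v + pairCost L′ σ s v u)) (pairAccess-delay x L u∈ v∈)))
      where L′ = moveTo m x L

    swaps-potential : ∀ {l} is (L : Vec A l) s → u ∈ₗ toList L → v ∈ₗ toList L →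
      potential (precedes u v (swaps is L)) s ≤
      potential (precedes u v L) s + 5 * (overtakes is L u v + overtakes is L v u)
    swaps-potential []       L s u∈ v∈ = m≤m+n _ _
    swaps-potential (i ∷ is) L s u∈ v∈ = begin
      potential (precedes u v (swaps is L′)) s
        ≤⟨ swaps-potential is L′ s u∈′ v∈′ ⟩
      potential (precedes u v L′) s + 5 * (overtakes is L′ u v + overtakes is L′ v u)
        ≤⟨ +-monoˡ-≤ _ (potential-reorder (precedes u v L) (precedes u v L′) s) ⟩
      potential (precedes u v L) s + 5 * (𝟙 (not (precedes u v L) ∧ precedes u v L′) + 𝟙 (precedes u v L ∧ not (precedes u v L′)))
        + 5 * (overtakes is L′ u v + overtakes is L′ v u)
        ≡⟨ cong₂ (λ b b′ → potential (precedes u v L) s + 5 * (𝟙 (b ∧ precedes u v L′) + 𝟙 (precedes u v L ∧ b′)) + 5 * (overtakes is L′ u v + overtakes is L′ v u))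
             (precedes-flip L u≢v u∈ v∈) (precedes-flip L′ u≢v u∈′ v∈′) ⟨
      potential (precedes u v L) s + 5 * (𝟙 (precedes v u L ∧ precedes u v L′) + 𝟙 (precedes u v L ∧ precedes v u L′))
        + 5 * (overtakes is L′ u v + overtakes is L′ v u)
        ≡⟨ regroup (potential (precedes u v L) s) (𝟙 (precedes v u L ∧ precedes u v L′)) (𝟙 (precedes u v L ∧ precedes v u L′)) (overtakes is L′ u v) (overtakes is L′ v u) ⟩
      potential (precedes u v L) s + 5 * (overtakes (i ∷ is) L u v + overtakes (i ∷ is) L v u)
        ∎
      where
      open ≤-Reasoning
      L′ = swapAt i L
      u∈′ = ∈-resp-↭ (↭-sym (swapAt-↭ i L)) u∈
      v∈′ = ∈-resp-↭ (↭-sym (swapAt-↭ i L)) v∈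
      regroup : ∀ p a b c d → p + 5 * (a + b) + 5 * (c + d) ≡ p + 5 * (a + c + (b + d))
      regroup = solve-∀

    serve-potential : ∀ {l} r x (L : Vec A l) s → x ∈ₗ toList L → u ∈ₗ toList L → v ∈ₗ toList L →
      delays (request x u v) s + potential (precedes u v (serve r x L)) (next (request x u v) s) ≤
      potential (precedes u v L) s + 5 * (pairServe r x L u v + pairServe r x L v u)
    serve-potential r x L s x∈ u∈ v∈ = begin
      delays q s + potential (precedes u v (serve r x L)) (next q s)
        ≤⟨ +-monoʳ-≤ (delays q s) (swaps-potential (after r) L₂ (next q s) (∈₂ u∈) (∈₂ v∈)) ⟩
      delays q s + (potential (precedes u v L₂) (next q s) + 5 * c)
        ≡⟨ +-assoc (delays q s) _ _ ⟨
      delays q s + potential (precedes u v L₂) (next q s) + 5 * c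
        ≡⟨ cong (λ b → delays q s + potential b (next q s) + 5 * c)
             (moveTo-precedes (free r) L₁ moved (∈₁ x∈) (∈₁ u∈) (∈₁ v∈) u≢v advanced) ⟩
      delays q s + potential (moveFront q (moved u v) (moved v u) (precedes u v L₁)) (next q s) + 5 * c
        ≤⟨ +-monoˡ-≤ (5 * c) (potential-request q (moved u v) (moved v u) (precedes u v L₁) s) ⟩
      potential (precedes u v L₁) s + 5 * delay q (precedes u v L₁) + 5 * c
        ≤⟨ +-monoˡ-≤ (5 * c) (+-monoˡ-≤ (5 * delay q (precedes u v L₁)) (swaps-potential (before r) L s u∈ v∈)) ⟩
      potential (precedes u v L) s + 5 * b + 5 * delay q (precedes u v L₁) + 5 * c
        ≡⟨ cong (λ d → potential (precedes u v L) s + 5 * b + 5 * d + 5 * c) (pairAccess-delay x L₁ (∈₁ u∈) (∈₁ v∈)) ⟨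
      potential (precedes u v L) s + 5 * b + 5 * (pairAccess x L₁ u v + pairAccess x L₁ v u) + 5 * c
        ≡⟨ regroup (potential (precedes u v L) s) (overtakes (before r) L u v) (overtakes (before r) L v u)
             (pairAccess x L₁ u v) (pairAccess x L₁ v u) (overtakes (after r) L₂ u v) (overtakes (after r) L₂ v u) ⟩
      potential (precedes u v L) s + 5 * (pairServe r x L u v + pairServe r x L v u)
        ∎
      where
      open ≤-Reasoning
      q = request x u v
      L₁ = swaps (before r) L
      L₂ = moveTo (free r) x L₁
      b = overtakes (before r) L u v + overtakes (before r) L v u
      c = overtakes (after r) L₂ u v + overtakes (after r) L₂ v u
      ∈₁ : ∀ {w} → w ∈ₗ toList L → w ∈ₗ toList L₁
      ∈₁ = ∈-resp-↭ (↭-sym (swaps-↭ (before r) L))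
      ∈₂ : ∀ {w} → w ∈ₗ toList L → w ∈ₗ toList L₂
      ∈₂ = ∈-resp-↭ (↭-sym (moveTo-↭ (free r) x L₁)) ∘ ∈₁
      -- Nothing is known about the offline choice, so `moved` is read off its result. The
      -- specification then only demands that `x` never loses a lead.
      moved : A → A → Bool
      moved y w = precedes y w L₂
      advanced : ∀ {w} → w ∈ₗ toList L₁ → w ≢ x → precedes x w L₂ ≡ precedes x w L₁ ∨ moved x w
      advanced {w} w∈ w≢x with precedes x w L₁ in x<w
      ... | true  = moveTo-advances (free r) L₁ (∈₁ x∈) w≢x x<w
      ... | false = refl
      regroup : ∀ p a a′ d d′ e e′ →
        p + 5 * (a + a′) + 5 * (d + d′) + 5 * (e + e′) ≡ p + 5 * (a + d + e + (a′ + d′ + e′))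
      regroup = solve-∀

    stateOf : ∀ {l} → List A → (Lᵗ Lᵒ Lᵉ : Vec A l) → PairState
    stateOf past Lᵗ Lᵒ Lᵉ = pairState (precedes u v Lᵗ) (precedes u v Lᵒ) (precedes u v Lᵉ)
      (odd u past) (odd v past) (credit u v past) (credit v u past)

    stateOf-next : ∀ {l x} past (Lᵗ Lᵒ Lᵉ : Vec A l) → Uniqueₗ (toList Lᵗ) → RecencyOrdered past Lᵗ →
      (∀ {w} → w ≡ x ⊎ w ≡ u ⊎ w ≡ v → w ∈ₗ toList Lᵗ × w ∈ₗ toList Lᵒ × w ∈ₗ toList Lᵉ) →
      stateOf (x ∷ past) (moveTo (tsMove past Lᵗ x) x Lᵗ) (moveTo (mtfMove 1ℙ past x) x Lᵒ) (moveTo (mtfMove 0ℙ past x) x Lᵉ)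
      ≡ next (request x u v) (stateOf past Lᵗ Lᵒ Lᵉ)
    stateOf-next {x = x} past Lᵗ Lᵒ Lᵉ uL ordered ∈L
      with ∈L (inj₁ refl) | ∈L (inj₂ (inj₁ refl)) | ∈L (inj₂ (inj₂ refl))
    ... | xᵗ , xᵒ , xᵉ | uᵗ , uᵒ , uᵉ | vᵗ , vᵒ , vᵉ
      rewrite moveTo-precedes (tsMove past Lᵗ x) Lᵗ (λ y w → positive (credit y w past)) xᵗ uᵗ vᵗ u≢v
                (tsMove-precedes past Lᵗ uL ordered xᵗ)
            | moveTo-precedes (mtfMove 1ℙ past x) Lᵒ (λ y _ → odd y past) xᵒ uᵒ vᵒ u≢v
                (front-precedes (odd x past) Lᵒ xᵒ)
            | moveTo-precedes (mtfMove 0ℙ past x) Lᵉ (λ y _ → not (odd y past)) xᵉ uᵉ vᵉ u≢v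
                (λ w∈ w≢x → trans (front-precedes (does (parity (suc (occurrences x past)) Parity.≟ 0ℙ)) Lᵉ xᵉ w∈ w≢x)
                  (cong (_ ∨_) (odd-even (parity (suc (occurrences x past))))))
            | odd-toggle u v x past | odd-toggle v u x past | request-flip x u≢v = refl

    -- The potential telescopes along the requests. The induction needs arbitrary current lists and
    -- an arbitrary past, since the four lists drift apart; the initial lists stay fixed as
    -- arguments of the online algorithms.
    pairCost-bound : ∀ {l} {I : List A} (Lᵗ Lᵒ Lᵉ L Lᵗ₀ Lᵒ₀ Lᵉ₀ : Vec A l) past → Uniqueₗ I → u ∈ₗ I → v ∈ₗ I →
      toList Lᵗ ↭ I → toList Lᵒ ↭ I → toList Lᵉ ↭ I → toList L ↭ I → RecencyOrdered past Lᵗ →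
      ∀ σ → All (_∈ₗ I) σ → (s : Schedule l σ) →
      let cᵗ = pairCost Lᵗ σ (runFrom TS Lᵗ₀ past Lᵗ σ)
          cᵒ = pairCost Lᵒ σ (runFrom MTFO Lᵒ₀ past Lᵒ σ)
          cᵉ = pairCost Lᵉ σ (runFrom MTFE Lᵉ₀ past Lᵉ σ)
          c  = pairCost L σ s
      in (cᵗ u v + cᵗ v u) + (cᵒ u v + cᵒ v u) + (cᵉ u v + cᵉ v u) ≤
         potential (precedes u v L) (stateOf past Lᵗ Lᵒ Lᵉ) + 5 * (c u v + c v u)
    pairCost-bound _ _ _ _ _ _ _ _ _ _ _ _ _ _ _ _ []      []          []      = z≤n
    pairCost-bound {I = I} Lᵗ Lᵒ Lᵉ L Lᵗ₀ Lᵒ₀ Lᵉ₀ past uI u∈ v∈ Lᵗ↭I Lᵒ↭I Lᵉ↭I L↭I ordered (x ∷ σ) (x∈ ∷ σ⊆I) (r ∷ s) = begin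
      (Cᵗ u v + Cᵗ v u) + (Cᵒ u v + Cᵒ v u) + (Cᵉ u v + Cᵉ v u)
        ≡⟨ cong₂ _+_ (cong₂ _+_
             (freeOnly-cost x Lᵗ (tsMove past Lᵗ x) σ _ (back Lᵗ↭I u∈) (back Lᵗ↭I v∈))
             (freeOnly-cost x Lᵒ (mtfMove 1ℙ past x) σ _ (back Lᵒ↭I u∈) (back Lᵒ↭I v∈)))
             (freeOnly-cost x Lᵉ (mtfMove 0ℙ past x) σ _ (back Lᵉ↭I u∈) (back Lᵉ↭I v∈)) ⟩
      (dᵗ + (cᵗ u v + cᵗ v u)) + (dᵒ + (cᵒ u v + cᵒ v u)) + (dᵉ + (cᵉ u v + cᵉ v u))
        ≡⟨ regroup dᵗ _ dᵒ _ dᵉ _ ⟩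
      delays q S + ((cᵗ u v + cᵗ v u) + (cᵒ u v + cᵒ v u) + (cᵉ u v + cᵉ v u))
        ≤⟨ +-monoʳ-≤ (delays q S) (pairCost-bound Lᵗ′ Lᵒ′ Lᵉ′ L′ Lᵗ₀ Lᵒ₀ Lᵉ₀ (x ∷ past) uI u∈ v∈
             (↭-trans (moveTo-↭ (tsMove past Lᵗ x) x Lᵗ) Lᵗ↭I) (↭-trans (moveTo-↭ (mtfMove 1ℙ past x) x Lᵒ) Lᵒ↭I)
             (↭-trans (moveTo-↭ (mtfMove 0ℙ past x) x Lᵉ) Lᵉ↭I) (↭-trans (serve-↭ r x L) L↭I)
             (RecencyOrdered-tsMove past Lᵗ uLᵗ ordered (back Lᵗ↭I x∈)) σ σ⊆I s) ⟩
      delays q S + (potential (precedes u v L′) (stateOf (x ∷ past) Lᵗ′ Lᵒ′ Lᵉ′) + 5 * (c u v + c v u))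
        ≡⟨ cong (λ S′ → delays q S + (potential (precedes u v L′) S′ + 5 * (c u v + c v u)))
             (stateOf-next past Lᵗ Lᵒ Lᵉ uLᵗ ordered λ w≡ → back Lᵗ↭I (members w≡) , back Lᵒ↭I (members w≡) , back Lᵉ↭I (members w≡)) ⟩
      delays q S + (potential (precedes u v L′) (next q S) + 5 * (c u v + c v u))
        ≡⟨ +-assoc (delays q S) _ _ ⟨
      delays q S + potential (precedes u v L′) (next q S) + 5 * (c u v + c v u)
        ≤⟨ +-monoˡ-≤ (5 * (c u v + c v u)) (serve-potential r x L S (back L↭I x∈) (back L↭I u∈) (back L↭I v∈)) ⟩
      potential (precedes u v L) S + 5 * (pairServe r x L u v + pairServe r x L v u) + 5 * (c u v + c v u)
        ≡⟨ regroup′ (potential (precedes u v L) S) (pairServe r x L u v) (pairServe r x L v u) (c u v) (c v u) ⟩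
      potential (precedes u v L) S + 5 * (pairCost L (x ∷ σ) (r ∷ s) u v + pairCost L (x ∷ σ) (r ∷ s) v u)
        ∎
      where
      open ≤-Reasoning
      q = request x u v
      S = stateOf past Lᵗ Lᵒ Lᵉ
      Cᵗ = pairCost Lᵗ (x ∷ σ) (runFrom TS Lᵗ₀ past Lᵗ (x ∷ σ))
      Cᵒ = pairCost Lᵒ (x ∷ σ) (runFrom MTFO Lᵒ₀ past Lᵒ (x ∷ σ))
      Cᵉ = pairCost Lᵉ (x ∷ σ) (runFrom MTFE Lᵉ₀ past Lᵉ (x ∷ σ))
      Lᵗ′ = moveTo (tsMove past Lᵗ x) x Lᵗ
      Lᵒ′ = moveTo (mtfMove 1ℙ past x) x Lᵒ
      Lᵉ′ = moveTo (mtfMove 0ℙ past x) x Lᵉ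
      L′ = serve r x L
      cᵗ = pairCost Lᵗ′ σ (runFrom TS Lᵗ₀ (x ∷ past) Lᵗ′ σ)
      cᵒ = pairCost Lᵒ′ σ (runFrom MTFO Lᵒ₀ (x ∷ past) Lᵒ′ σ)
      cᵉ = pairCost Lᵉ′ σ (runFrom MTFE Lᵉ₀ (x ∷ past) Lᵉ′ σ)
      c = pairCost L′ σ s
      dᵗ = delay q (precedes u v Lᵗ)
      dᵒ = delay q (precedes u v Lᵒ)
      dᵉ = delay q (precedes u v Lᵉ)
      uLᵗ = Unique-resp-↭ (↭-sym Lᵗ↭I) uI
      back : ∀ {w} {J : List A} → J ↭ I → w ∈ₗ I → w ∈ₗ J
      back J↭I = ∈-resp-↭ (↭-sym J↭I)
      members : ∀ {w} → w ≡ x ⊎ w ≡ u ⊎ w ≡ v → w ∈ₗ I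
      members (inj₁ refl)        = x∈
      members (inj₂ (inj₁ refl)) = u∈
      members (inj₂ (inj₂ refl)) = v∈
      regroup : ∀ d i e j f k → (d + i) + (e + j) + (f + k) ≡ (d + e + f) + (i + j + k)
      regroup = solve-∀
      regroup′ : ∀ p i j k m → p + 5 * (i + j) + 5 * (k + m) ≡ p + 5 * (i + k + (j + m))
      regroup′ = solve-∀

  -- Summation over all pairs, and the advice

  overtakes-diagonal : ∀ {l} is (L : Vec A l) u → overtakes is L u u ≡ 0
  overtakes-diagonal []       L u = refl
  overtakes-diagonal (i ∷ is) L u rewrite precedes-irrefl u L = overtakes-diagonal is (swapAt i L) u

  pairAccess-diagonal : ∀ {l} x (L : Vec A l) u → pairAccess x L u u ≡ 0
  pairAccess-diagonal x L u rewrite precedes-irrefl u L with does (u ≟ x)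
  ... | true  = refl
  ... | false = refl

  pairCost-diagonal : ∀ {l} (L : Vec A l) σ s u → pairCost L σ s u u ≡ 0
  pairCost-diagonal L []      []      u = refl
  pairCost-diagonal L (x ∷ σ) (r ∷ s) u = cong₂ _+_
    (cong₂ _+_ (cong₂ _+_ (overtakes-diagonal (before r) L u) (pairAccess-diagonal x (swaps (before r) L) u))
               (overtakes-diagonal (after r) (moveTo (free r) x (swaps (before r) L)) u))
    (pairCost-diagonal (serve r x L) σ s u)

  sum-of-costs : ∀ {l} (L : Vec A l) → Uniqueₗ (toList L) → ∀ σ → All (_∈ₗ toList L) σ → ∀ s →
    cost TS L σ + cost MTFO L σ + cost MTFE L σ ≤ 5 * scheduleCost L σ s
  sum-of-costs L uI σ σ⊆I s = *-cancelˡ-≤ 2 (begin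
    2 * (cost TS L σ + cost MTFO L σ + cost MTFE L σ)
      ≡⟨ cong (2 *_) (cong₂ _+_ (cong₂ _+_ (pairwise sᵗ) (pairwise sᵒ)) (pairwise sᵉ)) ⟩
    2 * ((n + ΣΣ[ I ] (c sᵗ)) + (n + ΣΣ[ I ] (c sᵒ)) + (n + ΣΣ[ I ] (c sᵉ)))
      ≡⟨ regroup n (ΣΣ[ I ] (c sᵗ)) (ΣΣ[ I ] (c sᵒ)) (ΣΣ[ I ] (c sᵉ)) ⟩
    6 * n + (2 * ΣΣ[ I ] (c sᵗ) + 2 * ΣΣ[ I ] (c sᵒ) + 2 * ΣΣ[ I ] (c sᵉ))
      ≡⟨ cong (6 * n +_) (cong₂ _+_ (cong₂ _+_ (ΣΣ-symmetrise I (c sᵗ)) (ΣΣ-symmetrise I (c sᵒ))) (ΣΣ-symmetrise I (c sᵉ))) ⟨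
    6 * n + (ΣΣ[ I ] (sym-c sᵗ) + ΣΣ[ I ] (sym-c sᵒ) + ΣΣ[ I ] (sym-c sᵉ))
      ≡⟨ cong (6 * n +_) (trans (ΣΣ-+ I _ _) (cong (_+ ΣΣ[ I ] (sym-c sᵉ)) (ΣΣ-+ I _ _))) ⟨
    6 * n + ΣΣ[ I ] (λ u v → sym-c sᵗ u v + sym-c sᵒ u v + sym-c sᵉ u v)
      -- 6 and 10 are twice 3 and 5: the fixed unit per request, doubled because every unordered
      -- pair is counted twice.
      ≤⟨ +-mono-≤ (*-monoˡ-≤ n {6} {10} (≤ᵇ⇒≤ 6 10 tt)) (ΣΣ-mono I pairBound) ⟩
    10 * n + ΣΣ[ I ] (λ u v → 5 * sym-c s u v)
      ≡⟨ cong (10 * n +_) (trans (ΣΣ-* 5 I _) (cong (5 *_) (ΣΣ-symmetrise I (c s)))) ⟩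
    10 * n + 5 * (2 * ΣΣ[ I ] (c s))
      ≡⟨ regroup′ n (ΣΣ[ I ] (c s)) ⟩
    2 * (5 * (n + ΣΣ[ I ] (c s)))
      ≡⟨ cong (λ k → 2 * (5 * k)) (pairwise s) ⟨
    2 * (5 * scheduleCost L σ s)
      ∎)
    where
    open ≤-Reasoning
    open Arrangements uI
    I = toList L
    n = length σ
    sᵗ = runFrom TS L [] L σ
    sᵒ = runFrom MTFO L [] L σ
    sᵉ = runFrom MTFE L [] L σ
    c = pairCost L σ
    sym-c : Schedule _ σ → A → A → ℕ
    sym-c s u v = c s u v + c s v u
    pairwise : ∀ s → scheduleCost L σ s ≡ n + ΣΣ[ I ] (c s)
    pairwise = scheduleCost-pairwise L ↭-refl σ σ⊆I
    pairBound : ∀ {u v} → u ∈ₗ I → v ∈ₗ I → sym-c sᵗ u v + sym-c sᵒ u v + sym-c sᵉ u v ≤ 5 * sym-c s u v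
    pairBound {u} {v} u∈ v∈ with u ≟ v
    ... | yes refl rewrite pairCost-diagonal L σ sᵗ u | pairCost-diagonal L σ sᵒ u | pairCost-diagonal L σ sᵉ u = z≤n
    ... | no u≢v   = subst (λ p → sym-c sᵗ u v + sym-c sᵒ u v + sym-c sᵉ u v ≤ p + 5 * sym-c s u v)
      (potential-initial (precedes u v L))
      (pairCost-bound u≢v L L L L L L L [] uI u∈ v∈ ↭-refl ↭-refl ↭-refl ↭-refl (RecencyOrdered-[] L) σ σ⊆I s)
    regroup : ∀ n i j k → 2 * ((n + i) + (n + j) + (n + k)) ≡ 6 * n + (2 * i + 2 * j + 2 * k)
    regroup = solve-∀
    regroup′ : ∀ n i → 10 * n + 5 * (2 * i) ≡ 2 * (5 * (n + i))
    regroup′ = solve-∀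

  -- Correct advice exists for every input, so the bound for an algorithm with correct advice is not
  -- vacuous.
  cheapest-advice : ∀ {l} (L : Vec A l) σ → ∃[ advice ] IndicatesCheapest advice L σ
  cheapest-advice L σ with ≤-total (cost TS L σ) (cost MTFO L σ) | ≤-total (cost TS L σ) (cost MTFE L σ)
                         | ≤-total (cost MTFO L σ) (cost MTFE L σ)
  ... | inj₁ t≤o | inj₁ t≤e | _        = false ∷ false ∷ [] , λ { ts → ≤-refl ; mtfo → t≤o ; mtfe → t≤e }
  ... | inj₁ t≤o | inj₂ e≤t | _        = true ∷ true ∷ [] , λ { ts → e≤t ; mtfo → ≤-trans e≤t t≤o ; mtfe → ≤-refl }
  ... | inj₂ o≤t | _        | inj₁ o≤e = false ∷ true ∷ [] , λ { ts → o≤t ; mtfo → ≤-refl ; mtfe → o≤e }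
  ... | inj₂ o≤t | _        | inj₂ e≤o = true ∷ true ∷ [] , λ { ts → ≤-trans e≤o o≤t ; mtfo → e≤o ; mtfe → ≤-refl }

toList-Unique : ∀ {a} {A : Set a} {l} {L : Vec A l} → Unique L → Uniqueₗ (toList L)
toList-Unique []        = []
toList-Unique (x≢ ∷ uL) = toList⁺ x≢ ∷ toList-Unique uL

3*min≤sum : ∀ {m i j k} → m ≤ i → m ≤ j → m ≤ k → 3 * m ≤ i + j + k
3*min≤sum {m} {i} {j} {k} m≤i m≤j m≤k = begin
  m + (m + (m + 0)) ≤⟨ +-mono-≤ m≤i (+-mono-≤ m≤j (+-monoˡ-≤ 0 m≤k)) ⟩
  i + (j + (k + 0)) ≡⟨ cong (λ k → i + (j + k)) (+-identityʳ k) ⟩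
  i + (j + k)       ≡⟨ +-assoc i j k ⟨
  i + j + k         ∎
  where open ≤-Reasoning

theorem3 : ∀ {a} {A : Set a} (_≟_ : DecidableEquality A) →
    let open ListUpdate _≟_ in
    ∀ {l} (L : Vec A l) → Unique L → (σ : List A) → All (_∈ L) σ →
    (3 * (cost TS L σ ⊓ cost MTFO L σ ⊓ cost MTFE L σ) ≤ 5 * OPT L σ)
    × (∃[ advice ] IndicatesCheapest advice L σ)
    × (∀ (advice : Vec Bool 2) → IndicatesCheapest advice L σ →
    3 * cost (bestOfThree advice) L σ ≤ 5 * OPT L σ)
theorem3 _≟_ L uL σ σ⊆L =
    ≤-trans (3*min≤sum
      (≤-trans (m⊓n≤m _ _) (m⊓n≤m (cost TS L σ) _))
      (≤-trans (m⊓n≤m _ _) (m⊓n≤n (cost TS L σ) _))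
      (m⊓n≤n _ _)) sum≤5OPT
  , cheapest-advice L σ
  , λ advice cheapest → ≤-trans (3*min≤sum (cheapest ts) (cheapest mtfo) (cheapest mtfe)) sum≤5OPT
  where
  open ListUpdate _≟_
  open PairwiseAnalysis _≟_
  sum≤5OPT : cost TS L σ + cost MTFO L σ + cost MTFE L σ ≤ 5 * OPT L σ
  -- `OPT L σ` is by definition the cost of the schedule `optimal L σ`, to which the bound for
  -- arbitrary schedules applies.
  sum≤5OPT = sum-of-costs L (toList-Unique uL) σ (All.map ∈-toList⁺ σ⊆L) (optimal L σ)
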